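{- Let $G$ be an abelian group and $\precsim$ a total quasi-order on $G$. Then $\precsim$ is compatible with $+$ (i.e. $(G,\precsim)$ satisfies $(Q_1)$ and $(Q_2)$ below) if and only if $G$ admits a subgroup $H$ satisfying: (1) $H$ is an initial segment of $(G,\precsim)$; (2) the restriction of $\precsim$ to $H$ makes $H$ an ordered abelian group (i.e. it is antisymmetric on $H$ and $x\precsim y\Rightarrow x+z\precsim y+z$ for all $x,y,z\in H$); (3) there exists a valuation $v$ on $G$ such that $v(h)>v(g)$ for all $h\in H$ and $g\in G\setminus H$, and such that for all $g,h\in G\setminus H$ we have $g\precsim h\Leftrightarrow v(g)\geq v(h)$.
   Context: A quasi-order is a reflexive transitive binary relation; it is total if any two elements are comparable. Write $a\sim b$ for $a\precsim b\wedge b\precsim a$. Compatibility axioms: $(Q_1)$ for all $x$, $x\sim 0\Rightarrow x=0$; $(Q_2)$ for all $x,y,z$, if $x\precsim y$ and $y\not\sim z$ then $x+z\precsim y+z$. A subset $S\subseteq G$ is an initial segment if $s\in S$ and $a\precsim s$ imply $a\in S$. A valuation on an abelian group $G$ is a map $v:G\to\Gamma\cup\{\infty\}$, where $\Gamma$ is a totally ordered set and $\gamma<\infty$ for all $\gamma\in\Gamma$, such that $v(g)=\infty\Leftrightarrow g=0$, $v(g+h)\geq\min(v(g),v(h))$, and $v(-g)=v(g)$ for all $g,h\in G$. -}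

module Defs where

open import Algebra.Bundles using (AbelianGroup)
import Algebra.Construct.NaturalChoice.Min as Min
open import Data.Product using (_×_; Σ-syntax)
open import Function.Bundles using (_⇔_)
open import Level using (Level; _⊔_; suc)
open import Relation.Binary.Bundles using (TotalOrder)
import Relation.Binary.Construct.Add.Supremum.NonStrict as AddSupremum
open import Relation.Binary.Core using (Rel; _Preserves_⟶_)
open import Relation.Binary.Definitions using (_Respects_)
import Relation.Binary.Properties.Poset as PosetProperties
open import Relation.Nullary using (¬_)
open import Relation.Nullary.Construct.Add.Supremum using (⊤⁺)
open import Relation.Unary using (Pred; _∈_; _∉_)

private
  variable
    c ℓ r h γ₁ γ₂ γ₃ : Level

-- Γ ∪ {∞}, where ∞ is ⊤⁺.
_∪∞ : TotalOrder γ₁ γ₂ γ₃ → TotalOrder γ₁ (γ₁ ⊔ γ₂) (γ₁ ⊔ γ₃)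
Γ ∪∞ = record { isTotalOrder = ≤⁺-isTotalOrder isTotalOrder }
  where
  open TotalOrder Γ
  open AddSupremum _≤_

module _ (G : AbelianGroup c ℓ) where
  open AbelianGroup G

  record IsSubgroup (H : Pred Carrier h) : Set (c ⊔ ℓ ⊔ h) where
    field
      resp      : H Respects _≈_
      ε-closed  : ε ∈ H
      ∙-closed  : ∀ {x y} → x ∈ H → y ∈ H → x ∙ y ∈ H
      ⁻¹-closed : ∀ {x} → x ∈ H → x ⁻¹ ∈ H

  record Valuation (Γ : TotalOrder γ₁ γ₂ γ₃) : Set (c ⊔ ℓ ⊔ γ₁ ⊔ γ₂ ⊔ γ₃) where
    private
      module Γ∞ = TotalOrder (Γ ∪∞)
    open Min (Γ ∪∞) using (_⊓_)
    field
      v      : Carrier → Γ∞.Carrier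
      v-cong : v Preserves _≈_ ⟶ Γ∞._≈_
      v-∞    : ∀ g → (v g Γ∞.≈ ⊤⁺) ⇔ (g ≈ ε)
      v-∙    : ∀ g h → v g ⊓ v h Γ∞.≤ v (g ∙ h)
      v-⁻¹   : ∀ g → v (g ⁻¹) Γ∞.≈ v g

  module _ (_≾_ : Rel Carrier r) where

    infix 4 _∼_
    _∼_ : Rel Carrier r
    a ∼ b = a ≾ b × b ≾ a

    record IsCompatible : Set (c ⊔ ℓ ⊔ r) where
      field
        Q₁ : ∀ x → x ∼ ε → x ≈ ε
        Q₂ : ∀ x y z → x ≾ y → ¬ (y ∼ z) → (x ∙ z) ≾ (y ∙ z)

    IsInitialSegment : Pred Carrier h → Set (c ⊔ r ⊔ h)
    IsInitialSegment S = ∀ s a → s ∈ S → a ≾ s → a ∈ S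

    -- The restriction of ≾ to H is an ordered abelian group.  Reflexivity,
    -- transitivity and totality are inherited from ≾ itself.
    record IsOrderedOn (H : Pred Carrier h) : Set (c ⊔ ℓ ⊔ r ⊔ h) where
      field
        antisym : ∀ x y → x ∈ H → y ∈ H → x ≾ y → y ≾ x → x ≈ y
        ∙-mono  : ∀ x y z → x ∈ H → y ∈ H → z ∈ H → x ≾ y → (x ∙ z) ≾ (y ∙ z)

    record IsInducedOutside (H : Pred Carrier h) {Γ : TotalOrder γ₁ γ₂ γ₃}
                            (val : Valuation Γ)
                            : Set (c ⊔ r ⊔ h ⊔ γ₁ ⊔ γ₂ ⊔ γ₃) where
      open Valuation val
      open TotalOrder (Γ ∪∞) using (_≤_; poset)
      open PosetProperties poset using (_<_)
      field
        outside<inside : ∀ h g → h ∈ H → g ∉ H → v g < v h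
        ≾⇔≥            : ∀ g h → g ∉ H → h ∉ H → (g ≾ h) ⇔ (v h ≤ v g)

    AdmitsDecomposition : ∀ u → Set (c ⊔ ℓ ⊔ r ⊔ suc u)
    AdmitsDecomposition u =
      Σ[ H ∈ Pred Carrier u ]
        IsSubgroup H × IsInitialSegment H × IsOrderedOn H ×
        (Σ[ Γ ∈ TotalOrder u u u ] Σ[ val ∈ Valuation Γ ] IsInducedOutside H val)

{-# OPTIONS --safe #-}

-- For a compatible total quasi-order take H = {x : x ≾ 0 or −x ≾ 0}.  Every
-- x ∉ H satisfies 0 ≾ x ∼ −x; this makes H an initial segment, hence a
-- subgroup, and ≾ obeys the ultrametric inequality outside H.  So v can send 0
-- to ∞, collapse H∖{0} to the largest finite value, and send the remaining
-- elements to their ∼-classes with the order reversed.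
-- Conversely, y ≁ z with y, z not both in H forces v(y) ≠ v(z), hence
-- v(y + z) = min(v(y), v(z)), and Q₂ reduces to the ultrametric inequality for
-- x + z.
module Submission where

open import Defs
open import Algebra.Bundles using (AbelianGroup)
import Algebra.Construct.NaturalChoice.Min as Min
import Algebra.Properties.AbelianGroup as AbelianGroupProperties
open import Axiom.ExcludedMiddle using (ExcludedMiddle)
open import Data.Product using (_×_; _,_; proj₁; proj₂; swap)
open import Data.Sum using (_⊎_; inj₁; inj₂; [_,_]′)
open import Function.Base using (_∘_)
open import Function.Bundles using (_⇔_; mk⇔; Equivalence)
open import Level using (Level; _⊔_; Lift; lift; lower)
open import Relation.Binary.Bundles using (TotalOrder)
open import Relation.Binary.Construct.Add.Point.Equality using (∙≈∙)
open import Relation.Binary.Construct.Add.Supremum.NonStrict using ([_]; _≤⊤⁺)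
open import Relation.Binary.Core using (Rel)
open import Relation.Binary.Definitions using (Decidable; _Respects_)
import Relation.Binary.Properties.Poset as PosetProperties
open import Relation.Binary.Structures using (IsTotalPreorder)
open import Relation.Nullary using (¬_; Dec; yes; no; contradiction)
open import Relation.Nullary.Construct.Add.Supremum using (⊤⁺; [_])
open import Relation.Nullary.Decidable using (map′; _×-dec_; _⊎-dec_; decidable-stable)
open import Relation.Unary using (Pred; _∈_; _∉_)
import Relation.Unary as Unary

-- From a compatible quasi-order to the decomposition

module CompatibleOrder {c ℓ r : Level} (G : AbelianGroup c ℓ)
  (R : Rel (AbelianGroup.Carrier G) r)
  (isTotalPreorder : IsTotalPreorder (AbelianGroup._≈_ G) R)
  (≈-dec : Decidable (AbelianGroup._≈_ G)) (≾-dec : Decidable R)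
  (compatible : IsCompatible G R) where

  open AbelianGroup G
  open AbelianGroupProperties G
  open IsTotalPreorder isTotalPreorder using (total)
    renaming (refl to ≾-refl; reflexive to ≾-reflexive; trans to ≾-trans)
  open IsCompatible compatible

  private
    infix 4 _≾_ _~_ _≈?_ _≾?_
    _≾_ _~_ : Rel Carrier r
    _≾_ = R
    _~_ = _∼_ G R

    _≈?_ : Decidable _≈_
    _≈?_ = ≈-dec

    _≾?_ : Decidable _≾_
    _≾?_ = ≾-dec

  ≁ε : ∀ {x} → ¬ x ≈ ε → ¬ (ε ~ x)
  ≁ε x≉ε = x≉ε ∘ Q₁ _ ∘ swap

  translate : ∀ {x y z a b} → x ≾ y → ¬ (y ~ z) → x ∙ z ≈ a → y ∙ z ≈ b → a ≾ b
  translate x≾y y≁z xz≈a yz≈b =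
    ≾-trans (≾-reflexive (sym xz≈a)) (≾-trans (Q₂ _ _ _ x≾y y≁z) (≾-reflexive yz≈b))

  -- Q₂ applies to `x ≾ ε` unless `y ∼ ε`; then `y ≈ ε` by Q₁, and the claim is `x ≾ ε` itself.
  ≾ε⇒∙-decreasing : ∀ {x} y → x ≾ ε → x ∙ y ≾ y
  ≾ε⇒∙-decreasing {x} y x≾ε with y ≈? ε
  ... | no y≉ε  = translate x≾ε (≁ε y≉ε) refl (identityˡ y)
  ... | yes y≈ε =
    ≾-trans (≾-reflexive (trans (∙-congˡ y≈ε) (identityʳ x)))
            (≾-trans x≾ε (≾-reflexive (sym y≈ε)))

  ≾ε⇒ε≾⁻¹ : ∀ {x} → x ≾ ε → ε ≾ x ⁻¹
  ≾ε⇒ε≾⁻¹ {x} x≾ε =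
    ≾-trans (≾-reflexive (sym (inverseʳ x))) (≾ε⇒∙-decreasing (x ⁻¹) x≾ε)

  ⁻¹≾ε⇒ε≾ : ∀ {x} → x ⁻¹ ≾ ε → ε ≾ x
  ⁻¹≾ε⇒ε≾ {x} x⁻¹≾ε = ≾-trans (≾ε⇒ε≾⁻¹ x⁻¹≾ε) (≾-reflexive (⁻¹-involutive x))

  -- The subgroup `H` and its order

  H : Pred Carrier r
  H x = x ≾ ε ⊎ x ⁻¹ ≾ ε

  _∈H? : Unary.Decidable H
  x ∈H? = (x ≾? ε) ⊎-dec (x ⁻¹ ≾? ε)

  H-resp : H Respects _≈_
  H-resp x≈y (inj₁ x≾ε)   = inj₁ (≾-trans (≾-reflexive (sym x≈y)) x≾ε)
  H-resp x≈y (inj₂ x⁻¹≾ε) = inj₂ (≾-trans (≾-reflexive (⁻¹-cong (sym x≈y))) x⁻¹≾ε)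

  H-ε : H ε
  H-ε = inj₁ ≾-refl

  H-⁻¹ : ∀ {x} → H x → H (x ⁻¹)
  H-⁻¹ {x} (inj₁ x≾ε)   = inj₂ (≾-trans (≾-reflexive (⁻¹-involutive x)) x≾ε)
  H-⁻¹     (inj₂ x⁻¹≾ε) = inj₁ x⁻¹≾ε

  H-⁻¹⁻ : ∀ {x} → H (x ⁻¹) → H x
  H-⁻¹⁻ {x} = H-resp (⁻¹-involutive x) ∘ H-⁻¹

  ∉H⇒ε≾ : ∀ {x} → ¬ H x → ε ≾ x
  ∉H⇒ε≾ {x} x∉H = [ (λ ε≾x → ε≾x) , (λ x≾ε → contradiction (inj₁ x≾ε) x∉H) ]′ (total ε x)

  -- Otherwise Q₂ translates `ε ≾ x` by `x ⁻¹`, which puts `x ⁻¹` below `ε`.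
  ∉H⇒~⁻¹ : ∀ {x} → ¬ H x → x ~ x ⁻¹
  ∉H⇒~⁻¹ {x} x∉H = decidable-stable ((x ≾? x ⁻¹) ×-dec (x ⁻¹ ≾? x)) λ x≁x⁻¹ →
    x∉H (inj₂ (translate (∉H⇒ε≾ x∉H) x≁x⁻¹ (identityˡ _) (inverseʳ x)))

  -- One of `x`, `x ⁻¹` is below `ε`, hence the other is above it, and equivalence squeezes `x` to
  -- `ε`. This supplies the side condition of Q₂ for translating a nonzero `y` in `H` by `y ⁻¹`.
  H∧~⁻¹⇒≈ε : ∀ {x} → H x → x ~ x ⁻¹ → x ≈ ε
  H∧~⁻¹⇒≈ε (inj₁ x≾ε)   (_ , x⁻¹≾x) = Q₁ _ (x≾ε , ≾-trans (≾ε⇒ε≾⁻¹ x≾ε) x⁻¹≾x)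
  H∧~⁻¹⇒≈ε (inj₂ x⁻¹≾ε) (x≾x⁻¹ , _) = Q₁ _ (≾-trans x≾x⁻¹ x⁻¹≾ε , ⁻¹≾ε⇒ε≾ x⁻¹≾ε)

  -- If a ∉ H lay below s with s⁻¹ ≾ ε, then s⁻¹ ≾ a ∙ s⁻¹ ≾ ε, and translating
  -- the first inequality by (a ∙ s⁻¹)⁻¹ would give a⁻¹ ≾ ε.
  H-initial : ∀ {s a} → H s → a ≾ s → H a
  H-initial (inj₁ s≾ε) a≾s = inj₁ (≾-trans a≾s s≾ε)
  H-initial {s} {a} s∈H@(inj₂ s⁻¹≾ε) a≾s = decidable-stable (a ∈H?) λ a∉H →
    let
      as⁻¹≾ε : (a ∙ s ⁻¹) ≾ ε
      as⁻¹≾ε = translate a≾s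
        (λ s~s⁻¹ → a∉H (inj₁ (≾-trans a≾s (≾-trans (proj₁ s~s⁻¹) s⁻¹≾ε))))
        refl (inverseʳ s)
      s⁻¹≾as⁻¹ : (s ⁻¹) ≾ (a ∙ s ⁻¹)
      s⁻¹≾as⁻¹ = translate (∉H⇒ε≾ a∉H)
        (λ a~s⁻¹ → a∉H (inj₁ (≾-trans (proj₁ a~s⁻¹) s⁻¹≾ε)))
        (identityˡ _) refl
      as⁻¹≁inverse : ¬ (a ∙ s ⁻¹ ~ (a ∙ s ⁻¹) ⁻¹)
      as⁻¹≁inverse p =
        a∉H (H-resp (sym (x∙y⁻¹≈ε⇒x≈y a s (H∧~⁻¹⇒≈ε (inj₁ as⁻¹≾ε) p))) s∈H)
      s⁻¹-as⁻¹≈a⁻¹ : s ⁻¹ ∙ (a ∙ s ⁻¹) ⁻¹ ≈ a ⁻¹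
      s⁻¹-as⁻¹≈a⁻¹ = trans (∙-congˡ (⁻¹-anti-homo‿- a s)) (\\-leftDividesʳ s (a ⁻¹))
    in a∉H (inj₂ (translate s⁻¹≾as⁻¹ as⁻¹≁inverse s⁻¹-as⁻¹≈a⁻¹ (inverseʳ _)))

  -- A summand below `ε` leaves the sum below the other summand, so initiality applies; if both
  -- inverses are below `ε`, so is their sum.
  H-∙ : ∀ {x y} → H x → H y → H (x ∙ y)
  H-∙ {x} {y} (inj₁ x≾ε) y∈H = H-initial y∈H (≾ε⇒∙-decreasing y x≾ε)
  H-∙ {x} {y} x∈H (inj₁ y≾ε) =
    H-initial x∈H (≾-trans (≾-reflexive (comm x y)) (≾ε⇒∙-decreasing x y≾ε))
  H-∙ {x} {y} (inj₂ x⁻¹≾ε) (inj₂ y⁻¹≾ε) =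
    inj₂ (≾-trans (≾-reflexive (sym (⁻¹-∙-comm x y)))
                  (≾-trans (≾ε⇒∙-decreasing (y ⁻¹) x⁻¹≾ε) y⁻¹≾ε))

  -- For `y ≉ ε`, translating both inequalities by `y ⁻¹` yields `x ∙ y ⁻¹ ∼ ε`. Q₂ permits this
  -- because `x ∼ y` and `y` is not equivalent to `y ⁻¹`.
  H-antisym : ∀ {x y} → H y → x ≾ y → y ≾ x → x ≈ y
  H-antisym {x} {y} y∈H x≾y y≾x with y ≈? ε
  ... | yes y≈ε = trans (Q₁ x (≾-trans x≾y (≾-reflexive y≈ε) ,
                               ≾-trans (≾-reflexive (sym y≈ε)) y≾x)) (sym y≈ε)
  ... | no y≉ε  = x∙y⁻¹≈ε⇒x≈y x y (Q₁ _
    ( translate x≾y y≁y⁻¹ refl (inverseʳ y)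
    , translate y≾x (λ (x≾y⁻¹ , y⁻¹≾x) → y≁y⁻¹ (≾-trans y≾x x≾y⁻¹ , ≾-trans y⁻¹≾x x≾y))
                (inverseʳ y) refl ))
    where
    y≁y⁻¹ : ¬ (y ~ y ⁻¹)
    y≁y⁻¹ = y≉ε ∘ H∧~⁻¹⇒≈ε y∈H

  -- The translation that Q₂ does not provide.
  ∙-monoˡ-self : ∀ {x y} → H y → x ≾ y → x ∙ y ≾ y ∙ y
  ∙-monoˡ-self {x} {y} y∈H x≾y with total (x ∙ y) (y ∙ y)
  ... | inj₁ xy≾yy = xy≾yy
  -- Translating the reverse inequality by `y ⁻¹` gives `y ≾ x`, hence `x ≈ y`. Q₂ blocks this only
  -- if `x ∙ y ∼ y ⁻¹`, which forces `y ≈ ε`.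
  ... | inj₂ yy≾xy with ((x ∙ y) ≾? (y ⁻¹)) ×-dec ((y ⁻¹) ≾? (x ∙ y))
  ...   | no xy≁y⁻¹ = ≾-reflexive (∙-congʳ (H-antisym y∈H x≾y
            (translate yy≾xy xy≁y⁻¹ (//-rightDividesʳ y y) (//-rightDividesʳ y x))))
  ...   | yes (xy≾y⁻¹ , y⁻¹≾xy) = ≾-trans (≾ε⇒∙-decreasing y (≾-trans x≾y y≾ε))
            (≾-reflexive (trans (sym (identityˡ y)) (∙-congʳ (sym (y≈ε y∈H)))))
    where
    -- Whichever of `y`, `y ⁻¹` is below `ε`, comparison through `x ∙ y` gives the missing half of
    -- `y ∼ y ⁻¹`.
    y≈ε : H y → y ≈ ε
    y≈ε (inj₁ y≾ε) = H∧~⁻¹⇒≈ε y∈H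
      ( ≾-trans y≾ε (≾ε⇒ε≾⁻¹ y≾ε)
      , ≾-trans y⁻¹≾xy (≾ε⇒∙-decreasing y (≾-trans x≾y y≾ε)) )
    y≈ε (inj₂ y⁻¹≾ε) = H∧~⁻¹⇒≈ε y∈H
      ( ≾-trans (≾-reflexive (sym (//-rightDividesʳ y y)))
                (≾ε⇒∙-decreasing (y ⁻¹) (≾-trans yy≾xy (≾-trans xy≾y⁻¹ y⁻¹≾ε)))
      , ≾-trans y⁻¹≾ε (⁻¹≾ε⇒ε≾ y⁻¹≾ε) )
    y≾ε : y ≾ ε
    y≾ε = ≾-reflexive (y≈ε y∈H)

  -- Inside `H`, `y ∼ z` means `y ≈ z`, so the case left open by Q₂ is translation by `y` itself.
  H-∙-mono : ∀ {x y z} → H y → H z → x ≾ y → x ∙ z ≾ y ∙ z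
  H-∙-mono {x} {y} {z} y∈H z∈H x≾y with (y ≾? z) ×-dec (z ≾? y)
  ... | no y≁z = Q₂ x y z x≾y y≁z
  ... | yes (y≾z , z≾y) =
    ≾-trans (≾-reflexive (∙-congˡ (sym y≈z)))
            (≾-trans (∙-monoˡ-self y∈H x≾y) (≾-reflexive (∙-congˡ y≈z)))
    where
    y≈z : y ≈ z
    y≈z = H-antisym z∈H y≾z z≾y

  -- Put k = g ∙ h ∉ H and suppose k ≾ h fails, so that k ≁ g and k ≁ h.  If g ∉ H,
  -- translating ε ≾ g and g ≾ g⁻¹ by k gives k ≾ g ∙ k ≾ g⁻¹ ∙ k = h; if g ∈ H,
  -- translating g ≾ h by k⁻¹ gives h⁻¹ ≾ g⁻¹, whence h ∈ H.
  ∙-≾-larger : ∀ {g h} → ¬ H (g ∙ h) → g ≾ h → g ∙ h ≾ h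
  ∙-≾-larger {g} {h} k∉H g≾h = decidable-stable ((g ∙ h) ≾? h) absurd
    where
    k : Carrier
    k = g ∙ h

    absurd : ¬ ¬ (k ≾ h)
    absurd k⋠h with g ∈H?
    ... | no g∉H = k⋠h (≾-trans
      (translate (∉H⇒ε≾ g∉H) (λ (_ , k≾g) → k⋠h (≾-trans k≾g g≾h)) (identityˡ k) refl)
      (translate (proj₁ (∉H⇒~⁻¹ g∉H))
        (λ (_ , k≾g⁻¹) → k⋠h (≾-trans k≾g⁻¹ (≾-trans (proj₂ (∉H⇒~⁻¹ g∉H)) g≾h)))
        refl (\\-leftDividesʳ g h)))
    ... | yes g∈H = k∉H (H-∙ g∈H (H-⁻¹⁻ (H-initial (H-⁻¹ g∈H) h⁻¹≾g⁻¹)))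
      where
      h∙k⁻¹≈g⁻¹ : h ∙ k ⁻¹ ≈ g ⁻¹
      h∙k⁻¹≈g⁻¹ = trans (∙-congˡ (⁻¹-anti-homo-∙ g h)) (\\-leftDividesˡ h (g ⁻¹))
      g∙k⁻¹≈h⁻¹ : g ∙ k ⁻¹ ≈ h ⁻¹
      g∙k⁻¹≈h⁻¹ = trans (∙-congˡ (sym (⁻¹-∙-comm g h))) (\\-leftDividesˡ g (h ⁻¹))
      h⁻¹≾g⁻¹ : h ⁻¹ ≾ g ⁻¹
      h⁻¹≾g⁻¹ = translate g≾h
        (λ (_ , k⁻¹≾h) → k⋠h (≾-trans (proj₁ (∉H⇒~⁻¹ k∉H)) k⁻¹≾h)) g∙k⁻¹≈h⁻¹ h∙k⁻¹≈g⁻¹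

  ultrametric : ∀ {g h} → ¬ H (g ∙ h) → g ∙ h ≾ g ⊎ g ∙ h ≾ h
  ultrametric {g} {h} k∉H with total g h
  ... | inj₁ g≾h = inj₂ (∙-≾-larger k∉H g≾h)
  ... | inj₂ h≾g = inj₁ (≾-trans (≾-reflexive (comm g h))
                          (∙-≾-larger (k∉H ∘ H-resp (comm h g)) h≾g))

  -- The valuation and its value set

  private
    u : Level
    u = c ⊔ ℓ ⊔ r

  -- The decomposition takes its subgroup and its value set at one common level, hence the lifts.
  Hᵤ : Pred Carrier u
  Hᵤ = Lift u ∘ H

  infix 4 _⊑_
  -- The order of finite values pulled back to `G`: `≾` reversed, with `H` collapsed to one largest
  -- class.
  _⊑_ : Rel Carrier r
  g ⊑ h = H h ⊎ h ≾ g

  ⊑-trans : ∀ {g h k} → g ⊑ h → h ⊑ k → g ⊑ k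
  ⊑-trans _          (inj₁ k∈H) = inj₁ k∈H
  ⊑-trans (inj₁ h∈H) (inj₂ k≾h) = inj₁ (H-initial h∈H k≾h)
  ⊑-trans (inj₂ h≾g) (inj₂ k≾h) = inj₂ (≾-trans k≾h h≾g)

  -- The quotient by mutual `⊑` is represented by `G` itself with a coarser equality.
  valueOrder : TotalOrder u u u
  valueOrder = record
    { Carrier = Lift u Carrier
    ; _≈_ = λ (lift g) (lift h) → Lift u (g ⊑ h × h ⊑ g)
    ; _≤_ = λ (lift g) (lift h) → Lift u (g ⊑ h)
    ; isTotalOrder = record
      { isPartialOrder = record
        { isPreorder = record
          { isEquivalence = record
            { refl  = lift (inj₂ ≾-refl , inj₂ ≾-refl)
            ; sym   = λ (lift p) → lift (swap p)
            ; trans = λ (lift (p , p′)) (lift (q , q′)) → lift (⊑-trans p q , ⊑-trans q′ p′)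
            }
          ; reflexive = λ (lift (p , _)) → lift p
          ; trans     = λ (lift p) (lift q) → lift (⊑-trans p q)
          }
        ; antisym = λ (lift p) (lift q) → lift (p , q)
        }
      ; total = λ (lift g) (lift h) →
          [ (λ g≾h → inj₂ (lift (inj₂ g≾h))) , (λ h≾g → inj₁ (lift (inj₂ h≾g))) ]′ (total g h)
      }
    }

  private
    module Γ∞ = TotalOrder (valueOrder ∪∞)
    open Min (valueOrder ∪∞) using (_⊓_; x≤y⇒x⊓z≤y; x≤y⇒z⊓x≤y)

  v : Carrier → Γ∞.Carrier
  v g with g ≈? ε
  ... | yes _ = ⊤⁺
  ... | no  _ = [ lift g ]

  -- `⊑` does not separate `ε` from the rest of `H`; the first hypothesis rules out an infinite
  -- `v g` with a finite `v h`.
  v-≤⁺ : ∀ {g h} → (g ≈ ε → h ≈ ε) → g ⊑ h → v g Γ∞.≤ v h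
  v-≤⁺ {g} {h} g≈ε⇒h≈ε g⊑h with g ≈? ε | h ≈? ε
  ... | _       | yes _  = _ ≤⊤⁺
  ... | yes g≈ε | no h≉ε = contradiction (g≈ε⇒h≈ε g≈ε) h≉ε
  ... | no _    | no _   = [ lift g⊑h ]

  v-≤⁻ : ∀ {g h} → ¬ H h → v g Γ∞.≤ v h → h ≾ g
  v-≤⁻ {g} {h} h∉H vg≤vh with g ≈? ε | h ≈? ε | vg≤vh
  ... | _    | yes h≈ε | _              = contradiction (H-resp (sym h≈ε) H-ε) h∉H
  ... | no _ | no _    | [ lift (inj₁ h∈H) ] = contradiction h∈H h∉H
  ... | no _ | no _    | [ lift (inj₂ h≾g) ] = h≾g

  v-∞ : ∀ g → (v g Γ∞.≈ ⊤⁺) ⇔ (g ≈ ε)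
  v-∞ g with g ≈? ε
  ... | yes g≈ε = mk⇔ (λ _ → g≈ε) (λ _ → ∙≈∙)
  ... | no g≉ε  = mk⇔ (λ ()) (λ g≈ε → contradiction g≈ε g≉ε)

  v-cong : ∀ {g h} → g ≈ h → v g Γ∞.≈ v h
  v-cong g≈h = Γ∞.antisym
    (v-≤⁺ (trans (sym g≈h)) (inj₂ (≾-reflexive (sym g≈h))))
    (v-≤⁺ (trans g≈h) (inj₂ (≾-reflexive g≈h)))

  -- If a summand is `ε`, the sum is the other one. Otherwise a sum in `H` has at least the largest
  -- finite value, and a sum outside `H` obeys `ultrametric`.
  v-∙-sel : ∀ {g h} → Dec (g ≈ ε) → Dec (h ≈ ε) → Dec (H (g ∙ h)) →
            v g Γ∞.≤ v (g ∙ h) ⊎ v h Γ∞.≤ v (g ∙ h)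
  v-∙-sel {g} {h} (yes g≈ε) _ _ =
    inj₂ (Γ∞.reflexive (v-cong (sym (trans (∙-congʳ g≈ε) (identityˡ h)))))
  v-∙-sel {g} {h} (no _) (yes h≈ε) _ =
    inj₁ (Γ∞.reflexive (v-cong (sym (trans (∙-congˡ h≈ε) (identityʳ g)))))
  v-∙-sel (no g≉ε) (no _) (yes gh∈H) =
    inj₁ (v-≤⁺ (λ g≈ε → contradiction g≈ε g≉ε) (inj₁ gh∈H))
  v-∙-sel (no g≉ε) (no h≉ε) (no gh∉H) with ultrametric gh∉H
  ... | inj₁ gh≾g = inj₁ (v-≤⁺ (λ g≈ε → contradiction g≈ε g≉ε) (inj₂ gh≾g))
  ... | inj₂ gh≾h = inj₂ (v-≤⁺ (λ h≈ε → contradiction h≈ε h≉ε) (inj₂ gh≾h))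

  v-∙ : ∀ g h → v g ⊓ v h Γ∞.≤ v (g ∙ h)
  v-∙ g h = [ x≤y⇒x⊓z≤y (v h) , x≤y⇒z⊓x≤y (v g) ]′
              (v-∙-sel (g ≈? ε) (h ≈? ε) ((g ∙ h) ∈H?))

  ⊑-⁻¹ : ∀ g → g ⊑ (g ⁻¹) × (g ⁻¹) ⊑ g
  ⊑-⁻¹ g with g ∈H?
  ... | yes g∈H = inj₁ (H-⁻¹ g∈H) , inj₁ g∈H
  ... | no g∉H  = inj₂ (proj₂ (∉H⇒~⁻¹ g∉H)) , inj₂ (proj₁ (∉H⇒~⁻¹ g∉H))

  v-⁻¹ : ∀ g → v (g ⁻¹) Γ∞.≈ v g
  v-⁻¹ g = Γ∞.antisym
    (v-≤⁺ (λ g⁻¹≈ε → ⁻¹-injective (trans g⁻¹≈ε (sym ε⁻¹≈ε))) (proj₂ (⊑-⁻¹ g)))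
    (v-≤⁺ (λ g≈ε → trans (⁻¹-cong g≈ε) ε⁻¹≈ε) (proj₁ (⊑-⁻¹ g)))

  valuation : Valuation G valueOrder
  valuation = record { v = v ; v-cong = v-cong ; v-∞ = v-∞ ; v-∙ = v-∙ ; v-⁻¹ = v-⁻¹ }

  ∉H⇒≉ε : ∀ {g} → ¬ H g → ¬ g ≈ ε
  ∉H⇒≉ε g∉H g≈ε = g∉H (H-resp (sym g≈ε) H-ε)

  isInducedOutside : IsInducedOutside G _≾_ Hᵤ valuation
  isInducedOutside = record
    { outside<inside = λ h g (lift h∈H) g∉Hᵤ → let g∉H = g∉Hᵤ ∘ lift in
        v-≤⁺ (λ g≈ε → contradiction g≈ε (∉H⇒≉ε g∉H)) (inj₁ h∈H) ,
        -- Equal values would give `g ≾ h`, and initiality would put `g` in `H`.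
        λ vg≈vh → g∉H (H-initial h∈H (v-≤⁻ g∉H (Γ∞.reflexive (Γ∞.Eq.sym vg≈vh))))
    ; ≾⇔≥ = λ g h g∉Hᵤ h∉Hᵤ → mk⇔
        (λ g≾h → v-≤⁺ (λ h≈ε → contradiction h≈ε (∉H⇒≉ε (h∉Hᵤ ∘ lift))) (inj₂ g≾h))
        (v-≤⁻ (g∉Hᵤ ∘ lift))
    }

  decomposition : AdmitsDecomposition G _≾_ u
  decomposition = Hᵤ
    , record
      { resp      = λ x≈y (lift x∈H) → lift (H-resp x≈y x∈H)
      ; ε-closed  = lift H-ε
      ; ∙-closed  = λ (lift x∈H) (lift y∈H) → lift (H-∙ x∈H y∈H)
      ; ⁻¹-closed = λ (lift x∈H) → lift (H-⁻¹ x∈H)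
      }
    , (λ s a (lift s∈H) a≾s → lift (H-initial s∈H a≾s))
    , record
      { antisym = λ x y _ (lift y∈H) → H-antisym y∈H
      ; ∙-mono  = λ x y z _ (lift y∈H) (lift z∈H) → H-∙-mono y∈H z∈H
      }
    , valueOrder , valuation , isInducedOutside

-- Values of sums in a valued group

module ValuationProperties {c ℓ γ₁ γ₂ γ₃ : Level} (G : AbelianGroup c ℓ)
  {Γ : TotalOrder γ₁ γ₂ γ₃} (val : Valuation G Γ) where

  open AbelianGroup G
  open AbelianGroupProperties G
  open Valuation val
  private
    module Γ∞ = TotalOrder (Γ ∪∞)
  open Γ∞ using (_≤_)
  open Min (Γ ∪∞) using (⊓-sel; ⊓-glb)

  v-∙-sel : ∀ g h → v g ≤ v (g ∙ h) ⊎ v h ≤ v (g ∙ h)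
  v-∙-sel g h with ⊓-sel (v g) (v h)
  ... | inj₁ ⊓≈vg = inj₁ (Γ∞.trans (Γ∞.reflexive (Γ∞.Eq.sym ⊓≈vg)) (v-∙ g h))
  ... | inj₂ ⊓≈vh = inj₂ (Γ∞.trans (Γ∞.reflexive (Γ∞.Eq.sym ⊓≈vh)) (v-∙ g h))

  v-∙-glb : ∀ {γ g h} → γ ≤ v g → γ ≤ v h → γ ≤ v (g ∙ h)
  v-∙-glb γ≤vg γ≤vh = Γ∞.trans (⊓-glb γ≤vg γ≤vh) (v-∙ _ _)

  -- Write `g` as `(g ∙ h) ∙ h ⁻¹`: its value is at least `v (g ∙ h)` or at least `v h`, and the
  -- latter is excluded.
  v-∙-≤ˡ : ∀ {g h} → ¬ (v h ≤ v g) → v (g ∙ h) ≤ v g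
  v-∙-≤ˡ {g} {h} vh≰vg with v-∙-sel (g ∙ h) (h ⁻¹)
  ... | inj₁ p = Γ∞.trans p (Γ∞.reflexive (v-cong (//-rightDividesʳ h g)))
  ... | inj₂ p = contradiction
    (Γ∞.trans (Γ∞.reflexive (Γ∞.Eq.sym (v-⁻¹ h)))
              (Γ∞.trans p (Γ∞.reflexive (v-cong (//-rightDividesʳ h g))))) vh≰vg

  v-∙-≤ʳ : ∀ {g h} → ¬ (v g ≤ v h) → v (g ∙ h) ≤ v h
  v-∙-≤ʳ {g} {h} vg≰vh = Γ∞.trans (Γ∞.reflexive (v-cong (comm g h))) (v-∙-≤ˡ vg≰vh)

  ≰⇒≥ : ∀ {α β} → ¬ (α ≤ β) → β ≤ α
  ≰⇒≥ {α} {β} α≰β = [ (λ α≤β → contradiction α≤β α≰β) , (λ β≤α → β≤α) ]′ (Γ∞.total α β)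

  -- This is the half of `v (g ∙ h) = min (v g, v h)` that requires distinct values.
  v-distinct⇒∙-lowerBound : ∀ {g h} → ¬ (v g ≤ v h) ⊎ ¬ (v h ≤ v g) →
                            v (g ∙ h) ≤ v g × v (g ∙ h) ≤ v h
  v-distinct⇒∙-lowerBound (inj₁ vg≰vh) =
    Γ∞.trans (v-∙-≤ʳ vg≰vh) (≰⇒≥ vg≰vh) , v-∙-≤ʳ vg≰vh
  v-distinct⇒∙-lowerBound (inj₂ vh≰vg) =
    v-∙-≤ˡ vh≰vg , Γ∞.trans (v-∙-≤ˡ vh≰vg) (≰⇒≥ vh≰vg)

-- From the decomposition to compatibility

module DecomposedOrder {c ℓ r u γ₁ γ₂ γ₃ : Level} (G : AbelianGroup c ℓ)
  (R : Rel (AbelianGroup.Carrier G) r)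
  (isTotalPreorder : IsTotalPreorder (AbelianGroup._≈_ G) R)
  (H : Pred (AbelianGroup.Carrier G) u) (_∈H? : Unary.Decidable H)
  (isSubgroup : IsSubgroup G H) (initial : IsInitialSegment G R H)
  (isOrderedOn : IsOrderedOn G R H)
  {Γ : TotalOrder γ₁ γ₂ γ₃} (val : Valuation G Γ)
  (inducedOutside : IsInducedOutside G R H val) where

  open AbelianGroup G
  open IsTotalPreorder isTotalPreorder using (total)
  open IsSubgroup isSubgroup
  open IsOrderedOn isOrderedOn
  open Valuation val
  open IsInducedOutside inducedOutside
  open ValuationProperties G val
  private
    module Γ∞ = TotalOrder (Γ ∪∞)
  open Γ∞ using (_≤_)
  open PosetProperties Γ∞.poset using (<⇒≱)

  private
    infix 4 _≾_ _~_
    _≾_ _~_ : Rel Carrier r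
    _≾_ = R
    _~_ = _∼_ G R

  outside≤inside : ∀ {g h} → h ∈ H → g ∉ H → v g ≤ v h
  outside≤inside h∈H g∉H = proj₁ (outside<inside _ _ h∈H g∉H)

  inside≰outside : ∀ {g h} → h ∈ H → g ∉ H → ¬ (v h ≤ v g)
  inside≰outside h∈H g∉H = <⇒≱ (outside<inside _ _ h∈H g∉H)

  inside≾outside : ∀ {g h} → h ∈ H → g ∉ H → h ≾ g
  inside≾outside {g} {h} h∈H g∉H =
    [ (λ h≾g → h≾g) , (λ g≾h → contradiction (initial h g h∈H g≾h) g∉H) ]′ (total h g)

  -- Together with `≾⇒≥`, this extends the equivalence of condition (3) to every `g`: for `g` in `H`
  -- both sides hold.
  ≥⇒≾ : ∀ {g h} → h ∉ H → v h ≤ v g → g ≾ h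
  ≥⇒≾ {g} {h} h∉H vh≤vg with g ∈H?
  ... | yes g∈H = inside≾outside g∈H h∉H
  ... | no g∉H  = Equivalence.from (≾⇔≥ g h g∉H h∉H) vh≤vg

  ≾⇒≥ : ∀ {g h} → h ∉ H → g ≾ h → v h ≤ v g
  ≾⇒≥ {g} {h} h∉H g≾h with g ∈H?
  ... | yes g∈H = outside≤inside g∈H h∉H
  ... | no g∉H  = Equivalence.to (≾⇔≥ g h g∉H h∉H) g≾h

  ≁⇒v-distinct : ∀ {y z} → y ∉ H → z ∉ H → ¬ (y ~ z) → ¬ (v y ≤ v z) ⊎ ¬ (v z ≤ v y)
  ≁⇒v-distinct {y} {z} y∉H z∉H y≁z with total y z
  ... | inj₁ y≾z = inj₁ λ vy≤vz → y≁z (y≾z , ≥⇒≾ y∉H vy≤vz)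
  ... | inj₂ z≾y = inj₂ λ vz≤vy → y≁z (≥⇒≾ z∉H vz≤vy , z≾y)

  ∉H-antitone : ∀ {g h} → h ∉ H → v g ≤ v h → g ∉ H
  ∉H-antitone h∉H vg≤vh g∈H = inside≰outside g∈H h∉H vg≤vh

  -- `v (y ∙ z)` lies below `v z` and below `v y ≤ v x`, hence below `v (x ∙ z)`; being below `v y`,
  -- it also keeps `y ∙ z` outside `H`.
  translate-outside : ∀ {x y z} → y ∉ H → ¬ (v y ≤ v z) ⊎ ¬ (v z ≤ v y) →
                      x ≾ y → x ∙ z ≾ y ∙ z
  translate-outside y∉H distinct x≾y with v-distinct⇒∙-lowerBound distinct
  ... | vyz≤vy , vyz≤vz =
    ≥⇒≾ (∉H-antitone y∉H vyz≤vy) (v-∙-glb (Γ∞.trans vyz≤vy (≾⇒≥ y∉H x≾y)) vyz≤vz)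

  -- The value of `z` is smaller than those of `x` and `y`, so `v (y ∙ z) ≤ v z ≤ v (x ∙ z)`. By
  -- symmetry the two sums are even equivalent.
  translate-by-outside : ∀ {x y z} → x ∈ H → y ∈ H → z ∉ H → x ∙ z ≾ y ∙ z
  translate-by-outside x∈H y∈H z∉H
    with v-distinct⇒∙-lowerBound (inj₁ (inside≰outside y∈H z∉H))
  ... | _ , vyz≤vz =
    ≥⇒≾ (∉H-antitone z∉H vyz≤vz) (v-∙-glb (Γ∞.trans vyz≤vz (outside≤inside x∈H z∉H)) vyz≤vz)

  compatible : IsCompatible G _≾_
  compatible = record
    { Q₁ = λ x (x≾ε , ε≾x) → antisym x ε (initial ε x ε-closed x≾ε) ε-closed x≾ε ε≾x
    ; Q₂ = Q₂
    }
    where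
    Q₂ : ∀ x y z → x ≾ y → ¬ (y ~ z) → x ∙ z ≾ y ∙ z
    -- If exactly one of `y`, `z` lies in `H`, condition (3) separates their values; if both lie
    -- outside, `y≁z` does.
    Q₂ x y z x≾y y≁z with y ∈H? | z ∈H?
    ... | yes y∈H | yes z∈H = ∙-mono x y z (initial y x y∈H x≾y) y∈H z∈H x≾y
    ... | yes y∈H | no z∉H  = translate-by-outside (initial y x y∈H x≾y) y∈H z∉H
    ... | no y∉H  | yes z∈H = translate-outside y∉H (inj₂ (inside≰outside z∈H y∉H)) x≾y
    ... | no y∉H  | no z∉H  = translate-outside y∉H (≁⇒v-distinct y∉H z∉H y≁z) x≾y

mainTheorem1 : ∀ {c ℓ r : Level} → ExcludedMiddle (c ⊔ ℓ ⊔ r) →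
    (G : AbelianGroup c ℓ) (_≾_ : Rel (AbelianGroup.Carrier G) r) →
    IsTotalPreorder (AbelianGroup._≈_ G) _≾_ →
    IsCompatible G _≾_ ⇔ AdmitsDecomposition G _≾_ (c ⊔ ℓ ⊔ r)
mainTheorem1 {c} {ℓ} {r} em G _≾_ isTotalPreorder = mk⇔
  (CompatibleOrder.decomposition G _≾_ isTotalPreorder
    -- Lifting `≈` and `≾` to the common level lets the one instance of excluded middle decide both.
    (λ _ _ → map′ lower lift (em {Lift (c ⊔ r) _}))
    (λ _ _ → map′ lower lift (em {Lift (c ⊔ ℓ) _})))
  (λ (H , isSubgroup , initial , isOrderedOn , _ , val , inducedOutside) →
    DecomposedOrder.compatible G _≾_ isTotalPreorder H (λ _ → em)
      isSubgroup initial isOrderedOn val inducedOutside)
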